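{- Let $k\geq1$, $n\geq1$ and $1\leq j\leq n$. The number of $k$-box paths of size $n$ with exactly $j$ returns is \[\grave{f}_{k,n,j}=\frac{j(k+1)-1}{(k+2)n-j-1}\binom{(k+2)n-j-1}{n-j},\] and for $j<n$ this also equals $\frac{j(k+1)-1}{n-j}\binom{(k+2)n-j-2}{n-j-1}$.
   Context: A skew Dyck path is a word $w$ over $\{U,D,L\}$ such that: $w$ contains neither $UL$ nor $LU$ as a contiguous subword; the number of $U$s equals the total number of $D$s and $L$s; and in every prefix the total number of $D$s and $L$s is at most the number of $U$s. Geometrically $U=(1,1)$, $D=(1,-1)$, $L=(-1,-1)$ starting at the origin. Its semilength is its number of $U$s. A factor is a contiguous subword; $X^{m}$ denotes $m$ consecutive copies of $X$. For $k\geq1$, a $k$-box path of size $n$ is a skew Dyck path of semilength $(k+2)n-1$ containing exactly $n$ occurrences of the factor $UD^{k}L$. A return is a point where a step of the path ends on the $x$-axis (equivalently, a nonempty prefix in which the number of $U$s equals the total number of $D$s and $L$s). -}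

module Defs where

open import Data.Bool using (Bool; true; false; _∧_; not; if_then_else_)
open import Data.Nat using (ℕ; zero; suc; _+_; _*_; _∸_; _≡ᵇ_; _≤ᵇ_)
open import Data.List using (List; []; _∷_; _++_; [_]; replicate; inits; tails; map; concatMap; null; length)

-- Steps: U = (1,1), D = (1,-1), L = (-1,-1)
data Step : Set where
  U D L : Step

isU : Step → Bool
isU U = true
isU _ = false

#U : List Step → ℕ
#U [] = 0
#U (U ∷ w) = suc (#U w)
#U (_ ∷ w) = #U w

#DL : List Step → ℕ
#DL [] = 0
#DL (U ∷ w) = #DL w
#DL (_ ∷ w) = suc (#DL w)

noULorLU : List Step → Bool
noULorLU (U ∷ L ∷ w) = false
noULorLU (L ∷ U ∷ w) = false
noULorLU (x ∷ w) = noULorLU w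
noULorLU [] = true

allB : {A : Set} → (A → Bool) → List A → Bool
allB p [] = true
allB p (x ∷ xs) = p x ∧ allB p xs

isSkewDyck : List Step → Bool
isSkewDyck w = noULorLU w ∧ (#U w ≡ᵇ #DL w) ∧ allB (λ p → #DL p ≤ᵇ #U p) (inits w)

words : ℕ → List (List Step)
words zero = [] ∷ []
words (suc m) = concatMap (λ w → (U ∷ w) ∷ (D ∷ w) ∷ (L ∷ w) ∷ []) (words m)

countWhere : {A : Set} → (A → Bool) → List A → ℕ
countWhere p [] = 0
countWhere p (x ∷ xs) = (if p x then 1 else 0) + countWhere p xs

skewDyckPaths : ℕ → List (List Step)
skewDyckPaths m = go (words (2 * m))
  where
  go : List (List Step) → List (List Step)
  go [] = []
  go (w ∷ ws) = if isSkewDyck w then w ∷ go ws else go ws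

eqStep : Step → Step → Bool
eqStep U U = true
eqStep D D = true
eqStep L L = true
eqStep _ _ = false

startsWith : List Step → List Step → Bool
startsWith [] w = true
startsWith (x ∷ p) [] = false
startsWith (x ∷ p) (y ∷ w) = eqStep x y ∧ startsWith p w

occurrences : List Step → List Step → ℕ
occurrences p w = countWhere (startsWith p) (tails w)

box : ℕ → List Step
box k = U ∷ (replicate k D ++ [ L ])

returns : List Step → ℕ
returns w = countWhere (λ p → not (null p) ∧ (#U p ≡ᵇ #DL p)) (inits w)

kBoxPathsWithReturns : ℕ → ℕ → ℕ → ℕ
kBoxPathsWithReturns k n j =
  countWhere (λ w → (occurrences (box k) w ≡ᵇ n) ∧ (returns w ≡ᵇ j))
             (skewDyckPaths ((k + 2) * n ∸ 1))

{-# OPTIONS --safe #-}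

-- Every UDᵏL except the last is followed by a D (it cannot be followed by U), so n boxes
-- need at least (k+2)n - 1 down-steps.  The semilength is exactly this minimum, hence a
-- k-box path is a shuffle of single U's with blocks UDᵏLD, of height change -(k+1), followed
-- by a last UDᵏL.  Read backwards such a path goes down one unit at a time and jumps up by k+1,
-- and the returns other than the end point are the jumps made at height 0.  Moving these
-- j - 1 jumps to the front leaves a first passage from height h = j(k+1) - 1 to 0 with
-- r = n - j jumps; there are h / (h + (k+2)r) * C(h + (k+2)r, r) of them.

module Submission where

open import Defs
open import Data.Bool using (Bool; true; false; _∧_; not; if_then_else_; T)
open import Data.Bool.Properties using (∧-assoc; ∧-zeroʳ)
open import Data.Empty using (⊥; ⊥-elim)
open import Data.List using (List; []; _∷_; _++_; [_]; replicate; inits; map; null; length; filterᵇ; concatMap)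
open import Data.Nat using (ℕ; zero; suc; _+_; _*_; _∸_; _≤_; _<_; z≤n; s≤s; _≡ᵇ_; _≤ᵇ_; NonZero)
open import Data.Nat.Combinatorics using (_C_; nCk+nC[k+1]≡[n+1]C[k+1])
open import Data.Nat.Properties
open import Data.Nat.Tactic.RingSolver using (solve-∀)
open import Data.Product using (_×_; _,_; proj₁; proj₂)
open import Data.Sum using (inj₁; inj₂)
open import Data.Unit using (tt)
open import Function using (_∘_)
open import Relation.Binary.PropositionalEquality using (_≡_; refl; sym; trans; cong; cong₂; subst; module ≡-Reasoning)

-- Sums over all words of a given length.

⟦_⟧ : Bool → ℕ
⟦ b ⟧ = if b then 1 else 0

Σw : ℕ → (List Step → ℕ) → ℕ
Σw zero    f = f []
Σw (suc m) f = Σw m (f ∘ (U ∷_)) + (Σw m (f ∘ (D ∷_)) + Σw m (f ∘ (L ∷_)))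

countWhere-letters : ∀ p ws →
  countWhere p (concatMap (λ w → (U ∷ w) ∷ (D ∷ w) ∷ (L ∷ w) ∷ []) ws)
    ≡ countWhere (p ∘ (U ∷_)) ws + (countWhere (p ∘ (D ∷_)) ws + countWhere (p ∘ (L ∷_)) ws)
countWhere-letters p []       = refl
countWhere-letters p (w ∷ ws) rewrite countWhere-letters p ws =
  shuffle ⟦ p (U ∷ w) ⟧ ⟦ p (D ∷ w) ⟧ ⟦ p (L ∷ w) ⟧ _ _ _
  where
  shuffle : ∀ a b c x y z → a + (b + (c + (x + (y + z)))) ≡ (a + x) + ((b + y) + (c + z))
  shuffle = solve-∀

countWhere-words : ∀ m p → countWhere p (words m) ≡ Σw m (⟦_⟧ ∘ p)
countWhere-words zero    p = +-identityʳ _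
countWhere-words (suc m) p = trans (countWhere-letters p (words m))
  (cong₂ _+_ (countWhere-words m _) (cong₂ _+_ (countWhere-words m _) (countWhere-words m _)))

Σw-cong : ∀ m {f g} → (∀ w → length w ≡ m → f w ≡ g w) → Σw m f ≡ Σw m g
Σw-cong zero    f≗g = f≗g [] refl
Σw-cong (suc m) f≗g =
  cong₂ _+_ (rest U) (cong₂ _+_ (rest D) (rest L))
  where
  rest = λ x → Σw-cong m λ w |w| → f≗g (x ∷ w) (cong suc |w|)

Σw-const0 : ∀ m → Σw m (λ _ → 0) ≡ 0
Σw-const0 zero    = refl
Σw-const0 (suc m) rewrite Σw-const0 m = refl

Σw-zero : ∀ m {f} → (∀ w → length w ≡ m → f w ≡ 0) → Σw m f ≡ 0
Σw-zero m f≗0 = trans (Σw-cong m f≗0) (Σw-const0 m)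

Σw-+ : ∀ m f g → Σw m (λ w → f w + g w) ≡ Σw m f + Σw m g
Σw-+ zero    f g = refl
Σw-+ (suc m) f g
  rewrite Σw-+ m (f ∘ (U ∷_)) (g ∘ (U ∷_)) | Σw-+ m (f ∘ (D ∷_)) (g ∘ (D ∷_))
        | Σw-+ m (f ∘ (L ∷_)) (g ∘ (L ∷_)) =
    shuffle (Σw m (f ∘ (U ∷_))) (Σw m (g ∘ (U ∷_))) (Σw m (f ∘ (D ∷_)))
            (Σw m (g ∘ (D ∷_))) (Σw m (f ∘ (L ∷_))) (Σw m (g ∘ (L ∷_)))
  where
  shuffle : ∀ a x b y c z → (a + x) + ((b + y) + (c + z)) ≡ (a + (b + c)) + (x + (y + z))
  shuffle = solve-∀

-- Only words with the prefix `DⁱL` contribute, so the sum passes to the remaining `m` letters.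
Σw-prefix : ∀ i m (p : List Step → Bool) →
  Σw (suc i + m) (λ w → ⟦ startsWith (replicate i D ++ [ L ]) w ∧ p w ⟧)
    ≡ Σw m (λ v → ⟦ p (replicate i D ++ L ∷ v) ⟧)
Σw-prefix zero    m p rewrite Σw-const0 m = refl
Σw-prefix (suc i) m p
  rewrite Σw-const0 (i + m)
        | +-identityʳ (Σw (suc i + m) (λ w → ⟦ startsWith (replicate i D ++ [ L ]) w ∧ p (D ∷ w) ⟧))
  = Σw-prefix i m (p ∘ (D ∷_))

-- Skew Dyck paths and returns, read letter by letter.

-- Paths that start at height h instead of 0.
good : ℕ → List Step → Bool
good h       (U ∷ w) = good (suc h) w
good zero    []      = true
good (suc h) []      = false
good zero    (D ∷ w) = false
good zero    (L ∷ w) = false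
good (suc h) (D ∷ w) = good h w
good (suc h) (L ∷ w) = good h w

rets : ℕ → List Step → ℕ
rets h       []      = 0
rets h       (U ∷ w) = rets (suc h) w
rets zero    (D ∷ w) = 0
rets zero    (L ∷ w) = 0
rets (suc h) (D ∷ w) = ⟦ h ≡ᵇ 0 ⟧ + rets h w
rets (suc h) (L ∷ w) = ⟦ h ≡ᵇ 0 ⟧ + rets h w

allB-cong : {A : Set} {p q : A → Bool} → (∀ x → p x ≡ q x) → ∀ xs → allB p xs ≡ allB q xs
allB-cong p≗q []       = refl
allB-cong p≗q (x ∷ xs) = cong₂ _∧_ (p≗q x) (allB-cong p≗q xs)

allB-map : {A B : Set} (p : B → Bool) (f : A → B) → ∀ xs → allB p (map f xs) ≡ allB (p ∘ f) xs
allB-map p f []       = refl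
allB-map p f (x ∷ xs) = cong (p (f x) ∧_) (allB-map p f xs)

countWhere-cong : {A : Set} {p q : A → Bool} → (∀ x → p x ≡ q x) → ∀ xs →
  countWhere p xs ≡ countWhere q xs
countWhere-cong p≗q []       = refl
countWhere-cong p≗q (x ∷ xs) = cong₂ _+_ (cong ⟦_⟧ (p≗q x)) (countWhere-cong p≗q xs)

countWhere-map : {A B : Set} (p : B → Bool) (f : A → B) → ∀ xs →
  countWhere p (map f xs) ≡ countWhere (p ∘ f) xs
countWhere-map p f []       = refl
countWhere-map p f (x ∷ xs) = cong (⟦ p (f x) ⟧ +_) (countWhere-map p f xs)

countWhere-filterᵇ : {A : Set} (p q : A → Bool) → ∀ xs →
  countWhere p (filterᵇ q xs) ≡ countWhere (λ x → q x ∧ p x) xs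
countWhere-filterᵇ p q [] = refl
countWhere-filterᵇ p q (x ∷ xs) with q x
... | true  = cong (⟦ p x ⟧ +_) (countWhere-filterᵇ p q xs)
... | false = countWhere-filterᵇ p q xs

≤ᵇ-suc : ∀ m n → (suc m ≤ᵇ suc n) ≡ (m ≤ᵇ n)
≤ᵇ-suc zero    n = refl
≤ᵇ-suc (suc m) n = refl

above : ℕ → List Step → Bool
above h = allB (λ p → #DL p ≤ᵇ h + #U p) ∘ inits

endsOn0 : ℕ → List Step → Bool
endsOn0 h w = h + #U w ≡ᵇ #DL w

above-∷ : ∀ h x w → above h (x ∷ w) ≡ allB (λ p → #DL (x ∷ p) ≤ᵇ h + #U (x ∷ p)) (inits w)
above-∷ h x w = allB-map _ (x ∷_) (inits w)

-- Removing the first letter shifts the starting height in both tests alike. A down-step from height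
-- 0 already fails at the prefix of length one.
good-spec : ∀ h w → endsOn0 h w ∧ above h w ≡ good h w
good-spec zero    []      = refl
good-spec (suc h) []      = refl
good-spec h       (U ∷ w) rewrite +-suc h (#U w) = trans
  (cong (endsOn0 (suc h) w ∧_) (trans (above-∷ h U w)
    (allB-cong (λ p → cong (#DL p ≤ᵇ_) (+-suc h (#U p))) (inits w))))
  (good-spec (suc h) w)
good-spec zero    (D ∷ w) = ∧-zeroʳ _
good-spec zero    (L ∷ w) = ∧-zeroʳ _
good-spec (suc h) (D ∷ w) = trans
  (cong (endsOn0 h w ∧_) (trans (above-∷ (suc h) D w) (allB-cong (λ p → ≤ᵇ-suc (#DL p) _) (inits w))))
  (good-spec h w)
good-spec (suc h) (L ∷ w) = trans
  (cong (endsOn0 h w ∧_) (trans (above-∷ (suc h) L w) (allB-cong (λ p → ≤ᵇ-suc (#DL p) _) (inits w))))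
  (good-spec h w)

isSkewDyck-good : ∀ w → isSkewDyck w ≡ noULorLU w ∧ good 0 w
isSkewDyck-good w = cong (noULorLU w ∧_) (good-spec 0 w)

endsOn0⁺ : ℕ → List Step → Bool
endsOn0⁺ h w = not (null w) ∧ endsOn0 h w

returnsFrom visits : ℕ → List Step → ℕ
returnsFrom h = countWhere (endsOn0⁺ h) ∘ inits
visits      h = countWhere (endsOn0 h) ∘ inits

visits-returnsFrom : ∀ h w → visits h w ≡ ⟦ h ≡ᵇ 0 ⟧ + returnsFrom h w
visits-returnsFrom h []      rewrite +-identityʳ h = refl
visits-returnsFrom h (x ∷ w) = cong₂ (λ m n → ⟦ m ≡ᵇ 0 ⟧ + n) (+-identityʳ h)
  (trans (countWhere-map (endsOn0 h) (x ∷_) (inits w))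
    (sym (countWhere-map (endsOn0⁺ h) (x ∷_) (inits w))))

-- Without `x` the one-letter prefix becomes the empty one, which `returnsFrom` skips; the indicator
-- restores it.
returnsFrom-∷ : ∀ h h′ x w → (∀ p → endsOn0 h (x ∷ p) ≡ endsOn0 h′ p) →
  returnsFrom h (x ∷ w) ≡ ⟦ h′ ≡ᵇ 0 ⟧ + returnsFrom h′ w
returnsFrom-∷ h h′ x w eq = trans (countWhere-map (endsOn0⁺ h) (x ∷_) (inits w))
  (trans (countWhere-cong eq (inits w)) (visits-returnsFrom h′ w))

-- This needs `good h w`: `rets` stops counting once the path falls below the axis, while
-- `returnsFrom` goes on.
returnsFrom-rets : ∀ h w → good h w ≡ true → returnsFrom h w ≡ rets h w
returnsFrom-rets h       []      _ = refl
returnsFrom-rets h       (U ∷ w) g = trans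
  (returnsFrom-∷ h (suc h) U w (λ p → cong (_≡ᵇ #DL p) (+-suc h (#U p)))) (returnsFrom-rets (suc h) w g)
returnsFrom-rets (suc h) (D ∷ w) g = trans
  (returnsFrom-∷ (suc h) h D w (λ _ → refl)) (cong (⟦ h ≡ᵇ 0 ⟧ +_) (returnsFrom-rets h w g))
returnsFrom-rets (suc h) (L ∷ w) g = trans
  (returnsFrom-∷ (suc h) h L w (λ _ → refl)) (cong (⟦ h ≡ᵇ 0 ⟧ +_) (returnsFrom-rets h w g))

-- The filtering function inside skewDyckPaths is local, so it is identified by its equations.
filterᵇ-unique : {A : Set} (q : A → Bool) (g : List A → List A) → g [] ≡ [] →
  (∀ x xs → g (x ∷ xs) ≡ (if q x then x ∷ g xs else g xs)) → ∀ xs → g xs ≡ filterᵇ q xs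
filterᵇ-unique q g g[] g∷ []       = g[]
filterᵇ-unique q g g[] g∷ (x ∷ xs) with q x | g∷ x xs
... | true  | eq = trans eq (cong (x ∷_) (filterᵇ-unique q g g[] g∷ xs))
... | false | eq = trans eq (filterᵇ-unique q g g[] g∷ xs)

skewDyckPaths-filterᵇ : ∀ m → skewDyckPaths m ≡ filterᵇ isSkewDyck (words (2 * m))
-- With `words (2 * m)` abstracted to the variable `ws`, the goal determines the local function for
-- which the underscore stands.
skewDyckPaths-filterᵇ m with filterᵇ-unique isSkewDyck _ refl (λ _ _ → refl) | words (2 * m)
... | g≗filter | ws = g≗filter ws

-- Tests, step counts, runs of down-steps and partial shifts.

∧-true : ∀ {a b} → a ∧ b ≡ true → a ≡ true × b ≡ true
∧-true {true} {true} _ = refl , refl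

≡ᵇ-true : ∀ m n → (m ≡ᵇ n) ≡ true → m ≡ n
≡ᵇ-true m n eq = ≡ᵇ⇒≡ m n (subst T (sym eq) tt)

≡ᵇ-refl : ∀ n → (n ≡ᵇ n) ≡ true
≡ᵇ-refl zero    = refl
≡ᵇ-refl (suc n) = ≡ᵇ-refl n

<⇒≢ᵇ : ∀ {m n} → m < n → (m ≡ᵇ n) ≡ false
<⇒≢ᵇ {zero}  {suc n} _         = refl
<⇒≢ᵇ {suc m} {suc n} (s≤s m<n) = <⇒≢ᵇ m<n

false-if : ∀ {b} → (b ≡ true → ⊥) → b ≡ false
false-if {false} _ = refl
false-if {true}  f = ⊥-elim (f refl)

⟦false⟧-+ : ∀ {b n} → b ≡ false → n ≡ ⟦ b ⟧ + n
⟦false⟧-+ refl = refl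

good-balance : ∀ h w → good h w ≡ true → h + #U w ≡ #DL w
good-balance zero    []      _ = refl
good-balance h       (U ∷ w) g = trans (+-suc h (#U w)) (good-balance (suc h) w g)
good-balance (suc h) (D ∷ w) g = cong suc (good-balance h w g)
good-balance (suc h) (L ∷ w) g = cong suc (good-balance h w g)

length-#U-#DL : ∀ w → length w ≡ #U w + #DL w
length-#U-#DL []      = refl
length-#U-#DL (U ∷ w) = cong suc (length-#U-#DL w)
length-#U-#DL (D ∷ w) = trans (cong suc (length-#U-#DL w)) (sym (+-suc (#U w) (#DL w)))
length-#U-#DL (L ∷ w) = trans (cong suc (length-#U-#DL w)) (sym (+-suc (#U w) (#DL w)))

notU : List Step → Bool
notU (U ∷ _) = false
notU _       = true

noULorLU-L : ∀ w → noULorLU (L ∷ w) ≡ true → noULorLU w ≡ true × notU w ≡ true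
noULorLU-L []      _ = refl , refl
noULorLU-L (D ∷ w) p = p , refl
noULorLU-L (L ∷ w) p = p , refl

noULorLU-U : ∀ w → noULorLU (U ∷ w) ≡ true → noULorLU w ≡ true
noULorLU-U []      _ = refl
noULorLU-U (U ∷ w) p = p
noULorLU-U (D ∷ w) p = p

noULorLU-run : ∀ i v → noULorLU (replicate i D ++ L ∷ v) ≡ noULorLU (L ∷ v)
noULorLU-run zero    v = refl
noULorLU-run (suc i) v = noULorLU-run i v

good-run : ∀ i h v → good (suc (i + h)) (replicate i D ++ L ∷ v) ≡ good h v
good-run zero    h v = refl
good-run (suc i) h v = good-run i h v

good-run-low : ∀ {h i} v → h < i → good (suc h) (replicate i D ++ L ∷ v) ≡ false
good-run-low {zero}  {suc zero}    v _         = refl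
good-run-low {zero}  {suc (suc i)} v _         = refl
good-run-low {suc h} {suc i}       v (s≤s h<i) = good-run-low v h<i

rets-run : ∀ i h v → rets (suc (i + h)) (replicate i D ++ L ∷ v) ≡ ⟦ h ≡ᵇ 0 ⟧ + rets h v
rets-run zero    h v = refl
rets-run (suc i) h v = rets-run i h v

-- A shift of the height by `i`, extended by 0, so that a descent across the axis contributes
-- nothing.
down : ℕ → (ℕ → ℕ) → ℕ → ℕ
down zero    g h       = g h
down (suc i) g zero    = 0
down (suc i) g (suc h) = down i g h

down-< : ∀ {i h} g → h < i → down i g h ≡ 0
down-< {suc i} {zero}  g _         = refl
down-< {suc i} {suc h} g (s≤s h<i) = down-< g h<i

down-cong : ∀ i {f g} → (∀ h → f h ≡ g h) → ∀ h → down i f h ≡ down i g h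
down-cong zero    f≗g h       = f≗g h
down-cong (suc i) f≗g zero    = refl
down-cong (suc i) f≗g (suc h) = down-cong i f≗g h

down-elim : ∀ i {x} g h → (h < i → x ≡ 0) → (∀ h′ → h ≡ i + h′ → x ≡ g h′) → x ≡ down i g h
down-elim zero    g h       low high = high h refl
down-elim (suc i) g zero    low high = low (s≤s z≤n)
down-elim (suc i) g (suc h) low high =
  down-elim i g h (low ∘ s≤s) (λ h′ → high h′ ∘ cong suc)

down-const0 : ∀ i h → down i (λ _ → 0) h ≡ 0
down-const0 zero    h       = refl
down-const0 (suc i) zero    = refl
down-const0 (suc i) (suc h) = down-const0 i h

down-+ : ∀ i f g h → down i (λ h → f h + g h) h ≡ down i f h + down i g h
down-+ zero    f g h       = refl
down-+ (suc i) f g zero    = refl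
down-+ (suc i) f g (suc h) = down-+ i f g h

down-indicator : ∀ i {h₀ c} h → down i (λ h → ⟦ (h ≡ᵇ h₀) ∧ c ⟧) h ≡ ⟦ (h ≡ᵇ i + h₀) ∧ c ⟧
down-indicator zero    h       = refl
down-indicator (suc i) zero    = refl
down-indicator (suc i) (suc h) = down-indicator i h

-- Absorption for binomial coefficients.

nCk-absorption : ∀ n k → suc k * (suc n C suc k) ≡ suc n * (n C k)
nCk-absorption zero    zero    = refl
nCk-absorption zero    (suc k) = *-zeroʳ (suc (suc k))
nCk-absorption (suc n) zero    = begin
  1 * (suc (suc n) C 1)          ≡⟨ cong (1 *_) (sym (nCk+nC[k+1]≡[n+1]C[k+1] (suc n) 0)) ⟩
  1 * (1 + (suc n C 1))          ≡⟨ cong suc (nCk-absorption n 0) ⟩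
  1 + suc n * 1                  ∎
  where open ≡-Reasoning
nCk-absorption (suc n) (suc k) = begin
  suc (suc k) * (suc (suc n) C suc (suc k))
    ≡⟨ cong (suc (suc k) *_) (sym (nCk+nC[k+1]≡[n+1]C[k+1] (suc n) (suc k))) ⟩
  suc (suc k) * (x + y)              ≡⟨ expand k x y ⟩
  x + suc k * x + suc (suc k) * y    ≡⟨ cong₂ (λ a b → x + a + b) (nCk-absorption n k) (nCk-absorption n (suc k)) ⟩
  x + suc n * (n C k) + suc n * (n C suc k)
    ≡⟨ collect n x (n C k) (n C suc k) ⟩
  x + suc n * ((n C k) + (n C suc k)) ≡⟨ cong (λ a → x + suc n * a) (nCk+nC[k+1]≡[n+1]C[k+1] n k) ⟩
  suc (suc n) * x                    ∎
  where
  open ≡-Reasoning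
  x = suc n C suc k
  y = suc n C suc (suc k)
  expand : ∀ k x y → suc (suc k) * (x + y) ≡ x + suc k * x + suc (suc k) * y
  expand = solve-∀
  collect : ∀ n x a b → x + suc n * a + suc n * b ≡ x + suc n * (a + b)
  collect = solve-∀

module Boxes (κ : ℕ) where

  k = suc κ

  -- Boxes and the down-steps they need.

  startsDᵏL : List Step → Bool
  startsDᵏL = startsWith (replicate k D ++ [ L ])

  occ : List Step → ℕ
  occ = occurrences (box k)

  occ-run : ∀ i v → occ (replicate i D ++ L ∷ v) ≡ occ v
  occ-run zero    v = refl
  occ-run (suc i) v = occ-run i v

  startsWith-run : ∀ i v → startsWith (replicate i D ++ [ L ]) (replicate i D ++ L ∷ v) ≡ true
  startsWith-run zero    v = refl
  startsWith-run (suc i) v = startsWith-run i v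

  occ≤#U : ∀ w → occ w ≤ #U w
  occ≤#U []      = z≤n
  occ≤#U (D ∷ w) = occ≤#U w
  occ≤#U (L ∷ w) = occ≤#U w
  occ≤#U (U ∷ w) with startsDᵏL w
  ... | true  = s≤s (occ≤#U w)
  ... | false = m≤n⇒m≤1+n (occ≤#U w)

  mutual
    occ-bound : ∀ w → noULorLU w ≡ true → occ w * (2 + k) ≤ suc (#DL w)
    occ-bound []      p = z≤n
    occ-bound (D ∷ w) p = m≤n⇒m≤1+n (occ-bound-notU (D ∷ w) p refl)
    occ-bound (L ∷ w) p = m≤n⇒m≤1+n (occ-bound-notU (L ∷ w) p refl)
    occ-bound (U ∷ w) p with startsDᵏL w in eq
    ... | true  = s≤s (occ-bound-run k w eq (noULorLU-U w p))
    ... | false = occ-bound w (noULorLU-U w p)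

    -- Such a word is empty or begins with a down-step that lies in none of its boxes, and this step
    -- makes up for the one missing after the last box. What follows a box is always of this kind,
    -- as `LU` is forbidden.
    occ-bound-notU : ∀ w → noULorLU w ≡ true → notU w ≡ true → occ w * (2 + k) ≤ #DL w
    occ-bound-notU []      _ _ = z≤n
    occ-bound-notU (D ∷ w) p _ = occ-bound w p
    occ-bound-notU (L ∷ w) p _ = occ-bound w (proj₁ (noULorLU-L w p))

    occ-bound-run : ∀ i w → startsWith (replicate i D ++ [ L ]) w ≡ true → noULorLU w ≡ true →
      suc (i + occ w * (2 + k)) ≤ #DL w
    occ-bound-run zero    (L ∷ w) _ p = s≤s (occ-bound-notU w (proj₁ q) (proj₂ q))
      where q = noULorLU-L w p
    occ-bound-run (suc i) (D ∷ w) s p = s≤s (occ-bound-run i w s p)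

  -- Walks on states.

  -- A state is a height h with the numbers r of boxes and t of returns already made; one step is
  -- a single U or a whole block UDᵏLD.
  Weight : Set
  Weight = ℕ → ℕ → ℕ → ℕ

  -- A block that stays on or above the axis can touch it only at its end point, so it makes at most
  -- one return.
  step : Weight → Weight
  step f h r t = f (suc h) r t + down (suc k) (λ h′ → f h′ (suc r) (⟦ h′ ≡ᵇ 0 ⟧ + t)) h

  run : ℕ → Weight → Weight
  run zero    f = f
  run (suc s) f = step (run s f)

  -- With this weight `run s` counts the walks of `s` steps from a given state to the state `h₀`,
  -- `r₀`, `t₀`.
  δ : ℕ → ℕ → ℕ → Weight
  δ h₀ r₀ t₀ h r t = ⟦ (h ≡ᵇ h₀) ∧ (r ≡ᵇ r₀) ∧ (t ≡ᵇ t₀) ⟧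

  run-cong : ∀ s {f g} → (∀ h r t → f h r t ≡ g h r t) → ∀ h r t → run s f h r t ≡ run s g h r t
  run-cong zero    f≗g = f≗g
  run-cong (suc s) f≗g h r t = cong₂ _+_ (run-cong s f≗g (suc h) r t)
    (down-cong (suc k) (λ h′ → run-cong s f≗g h′ (suc r) _) h)

  -- Each step adds at most one box.
  run-few : ∀ s {h₀ r₀ t₀} h r t → s + r < r₀ → run s (δ h₀ r₀ t₀) h r t ≡ 0
  run-few zero    {h₀} h r t lt rewrite <⇒≢ᵇ lt | ∧-zeroʳ (h ≡ᵇ h₀) = refl
  run-few (suc s) {r₀ = r₀} h r t lt = cong₂ _+_ (run-few s (suc h) r t (<-trans (n<1+n _) lt))
    (trans (down-cong (suc k) (λ h′ → run-few s h′ (suc r) _ (subst (_< r₀) (sym (+-suc s r)) lt)) h)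
      (down-const0 (suc k) h))

  -- From accepted words to walks.

  -- R = n - 1 and J = j - 1: the last box, which has no D after it, is not a step of the walk.
  module _ (R J : ℕ) where

    accepts : ℕ → ℕ → ℕ → List Step → Bool
    accepts h r t w = noULorLU w ∧ good h w ∧ (r + occ w ≡ᵇ suc R) ∧ (t + rets h w ≡ᵇ suc J)

    accepts-elim : ∀ h r t b w → r + b ≡ R → accepts h r t w ≡ true →
      noULorLU w ≡ true × good h w ≡ true × occ w ≡ suc b
    accepts-elim h r t b w r+b q with ∧-true q
    ... | p , q′ with ∧-true {good h w} q′
    ... | g , q″ = p , g , +-cancelˡ-≡ r _ _
      (trans (≡ᵇ-true (r + occ w) (suc R) (proj₁ (∧-true {r + occ w ≡ᵇ suc R} q″)))
        (sym (trans (+-suc r b) (cong suc r+b))))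

    -- The length hypothesis says that #DL w, on an accepted w, is the minimum (b + 1)(k + 2) - 1.
    accepts-notU : ∀ h r t b w → r + b ≡ R → 2 + (h + length w) ≡ 2 * (suc b * (2 + k)) →
      notU w ≡ true → accepts h r t w ≡ false
    accepts-notU h r t b w r+b tight nu = false-if contra
      where
      contra : accepts h r t w ≡ true → ⊥
      contra q with accepts-elim h r t b w r+b q
      ... | p , g , o = 1+n≰n (subst (_≤ #DL w) occ≡ (occ-bound-notU w p nu))
        where
        open ≡-Reasoning
        regroup : ∀ d → 2 * suc d ≡ 2 + (d + d)
        regroup = solve-∀
        occ≡ : occ w * (2 + k) ≡ suc (#DL w)
        occ≡ = *-cancelˡ-≡ _ _ 2 (begin
          2 * (occ w * (2 + k))         ≡⟨ cong (λ o → 2 * (o * (2 + k))) o ⟩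
          2 * (suc b * (2 + k))         ≡⟨ sym tight ⟩
          2 + (h + length w)            ≡⟨ cong (λ l → 2 + (h + l)) (length-#U-#DL w) ⟩
          2 + (h + (#U w + #DL w))      ≡⟨ cong (2 +_) (sym (+-assoc h _ _)) ⟩
          2 + (h + #U w + #DL w)        ≡⟨ cong (λ d → 2 + (d + #DL w)) (good-balance h w g) ⟩
          2 + (#DL w + #DL w)           ≡⟨ sym (regroup (#DL w)) ⟩
          2 * suc (#DL w)               ∎)

    -- If `w` begins with `DᵏL`, the `U` opens a box and `accepts-notU` rejects `w` as a tight
    -- suffix. Otherwise the `U` is single and adds no box. So at most one summand is nonzero.
    accepts-U : ∀ h r t b w → r + b ≡ R → 2 + (suc h + length w) ≡ 2 * (suc b * (2 + k)) →
      ⟦ accepts h r t (U ∷ w) ⟧ ≡ ⟦ accepts (suc h) r t w ⟧ + ⟦ startsDᵏL w ∧ accepts h r t (U ∷ w) ⟧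
    accepts-U h r t b []      _ _ = refl
    accepts-U h r t b (U ∷ w) _ _ = sym (+-identityʳ _)
    accepts-U h r t b (L ∷ w) r+b tight = ⟦false⟧-+ (accepts-notU (suc h) r t b (L ∷ w) r+b tight refl)
    accepts-U h r t b (D ∷ w) r+b tight with startsDᵏL (D ∷ w)
    ... | true  = ⟦false⟧-+ (accepts-notU (suc h) r t b (D ∷ w) r+b tight refl)
    ... | false = sym (+-identityʳ _)

    -- A tight suffix must begin with `U`, which is either single or the start of a box.
    accepts-split : ∀ h r t b m → r + b ≡ R → 2 + (h + suc (suc k + m)) ≡ 2 * (suc b * (2 + k)) →
      Σw (suc (suc k + m)) (⟦_⟧ ∘ accepts h r t)
        ≡ Σw (suc k + m) (⟦_⟧ ∘ accepts (suc h) r t)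
          + Σw m (λ v → ⟦ accepts h r t (U ∷ replicate k D ++ L ∷ v) ⟧)
    accepts-split h r t b m r+b tight = begin
      _ ≡⟨ cong₂ (λ x y → Σw (suc k + m) (λ w → ⟦ accepts h r t (U ∷ w) ⟧) + (x + y)) noneD noneL ⟩
      _ ≡⟨ +-identityʳ _ ⟩
      _ ≡⟨ Σw-cong (suc k + m) {λ w → ⟦ accepts h r t (U ∷ w) ⟧}
             {λ w → ⟦ accepts (suc h) r t w ⟧ + ⟦ startsDᵏL w ∧ accepts h r t (U ∷ w) ⟧}
             (λ w |w| → accepts-U h r t b w r+b (trans (cong (2 +_)
               (trans (sym (+-suc h (length w))) (cong (λ l → h + suc l) |w|))) tight)) ⟩
      _ ≡⟨ Σw-+ (suc k + m) (λ w → ⟦ accepts (suc h) r t w ⟧)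
             (λ w → ⟦ startsDᵏL w ∧ accepts h r t (U ∷ w) ⟧) ⟩
      _ ≡⟨ cong (Σw (suc k + m) (⟦_⟧ ∘ accepts (suc h) r t) +_)
             (Σw-prefix k m (λ w → accepts h r t (U ∷ w))) ⟩
      _ ∎
      where
      open ≡-Reasoning
      noneD : Σw (suc k + m) (λ w → ⟦ accepts h r t (D ∷ w) ⟧) ≡ 0
      noneD = Σw-zero (suc k + m) {λ w → ⟦ accepts h r t (D ∷ w) ⟧} λ w |w| →
        cong ⟦_⟧ (accepts-notU h r t b (D ∷ w) r+b (trans (cong (λ l → 2 + (h + suc l)) |w|) tight) refl)
      noneL : Σw (suc k + m) (λ w → ⟦ accepts h r t (L ∷ w) ⟧) ≡ 0
      noneL = Σw-zero (suc k + m) {λ w → ⟦ accepts h r t (L ∷ w) ⟧} λ w |w| →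
        cong ⟦_⟧ (accepts-notU h r t b (L ∷ w) r+b (trans (cong (λ l → 2 + (h + suc l)) |w|) tight) refl)

    accepts-box : ∀ h r t v → accepts (k + h) r t (U ∷ replicate k D ++ L ∷ v)
      ≡ noULorLU (L ∷ v) ∧ good h v ∧ (suc r + occ v ≡ᵇ suc R) ∧ (t + (⟦ h ≡ᵇ 0 ⟧ + rets h v) ≡ᵇ suc J)
    accepts-box h r t v
      rewrite noULorLU-run κ v | good-run κ h v | startsWith-run κ v | occ-run κ v | +-suc r (occ v)
            | rets-run κ h v = refl

    accepts-box-low : ∀ {h} r t v → h < k → accepts h r t (U ∷ replicate k D ++ L ∷ v) ≡ false
    accepts-box-low {h} r t v h<k rewrite good-run-low v h<k = ∧-zeroʳ (noULorLU (replicate κ D ++ L ∷ v))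

    accepts-few : ∀ h r t b w → r + b ≡ R → #U w ≤ b → accepts h r t w ≡ false
    accepts-few h r t b w r+b few = false-if λ q →
      1+n≰n (≤-trans (subst (_≤ #U w) (proj₂ (proj₂ (accepts-elim h r t b w r+b q))) (occ≤#U w)) few)

    accepts-balance : ∀ h r t w → accepts h r t w ≡ true → h + (#U w + #U w) ≡ length w
    accepts-balance h r t w q = begin
      h + (#U w + #U w)   ≡⟨ shuffle h (#U w) ⟩
      #U w + (h + #U w)   ≡⟨ cong (#U w +_) (good-balance h w
                               (proj₁ (∧-true {good h w} (proj₂ (∧-true {noULorLU w} q))))) ⟩
      #U w + #DL w        ≡⟨ sym (length-#U-#DL w) ⟩
      length w            ∎
      where
      open ≡-Reasoning
      shuffle : ∀ h u → h + (u + u) ≡ u + (h + u)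
      shuffle = solve-∀

    -- The `suc b` missing boxes need as many `U`s, and by the balance an accepted word then has at
    -- least `h + 2 * suc b` letters.
    accepts-short : ∀ h r t b w → r + b ≡ R → length w ≤ h + (b + b) → accepts h r t w ≡ false
    accepts-short h r t b w r+b short = false-if λ q →
      let few = +-cancelˡ-≤ h _ _ (subst (_≤ h + (b + b)) (sym (accepts-balance h r t w q)) short)
          contra = λ (b<u : b < #U w) → <⇒≱ (+-mono-< b<u b<u) few
      in true≢false (trans (sym q) (accepts-few h r t b w r+b (≮⇒≥ contra)))
      where
      true≢false : true ≡ false → ⊥
      true≢false ()

    -- What remains to be tested once a box ending at height `h` has been read. Its `L` is kept so
    -- that a following `U` is still excluded.
    afterBox : ℕ → ℕ → ℕ → List Step → Bool
    afterBox h r t v =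
      noULorLU (L ∷ v) ∧ good h v ∧ (suc r + occ v ≡ᵇ suc R) ∧ (t + (⟦ h ≡ᵇ 0 ⟧ + rets h v) ≡ᵇ suc J)

    -- After a box that ends on the axis, `U` would form `LU` and a down-step would leave the upper
    -- half-plane.
    afterBox-0 : ∀ r t x v → afterBox 0 r t (x ∷ v) ≡ false
    afterBox-0 r t U v = refl
    afterBox-0 r t D v = ∧-zeroʳ _
    afterBox-0 r t L v = ∧-zeroʳ _

    afterBox-D : ∀ h r t v → afterBox (suc h) r t (D ∷ v) ≡ accepts h (suc r) (⟦ h ≡ᵇ 0 ⟧ + t) v
    afterBox-D h r t v =
      cong (λ n → noULorLU v ∧ good h v ∧ (suc r + occ v ≡ᵇ suc R) ∧ (n ≡ᵇ suc J))
        (shuffle t ⟦ h ≡ᵇ 0 ⟧ (rets h v))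
      where
      shuffle : ∀ t z s → t + (z + s) ≡ z + t + s
      shuffle = solve-∀

    -- After a second `L` the rest is again tight, so it would have to begin with `U`, but `LU` is
    -- forbidden. Hence a box that is not the last is followed by `D`.
    afterBox-L : ∀ h r t b v → suc r + b ≡ R → 2 + (h + length v) ≡ 2 * (suc b * (2 + k)) →
      afterBox (suc h) r t (L ∷ v) ≡ false
    afterBox-L h r t b (U ∷ v) r+b tight = refl
    afterBox-L h r t b []      r+b tight = trans (afterBox-D h r t [])
      (accepts-notU h (suc r) (⟦ h ≡ᵇ 0 ⟧ + t) b [] r+b tight refl)
    afterBox-L h r t b (D ∷ v) r+b tight = trans (afterBox-D h r t (D ∷ v))
      (accepts-notU h (suc r) (⟦ h ≡ᵇ 0 ⟧ + t) b (D ∷ v) r+b tight refl)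
    afterBox-L h r t b (L ∷ v) r+b tight = trans (afterBox-D h r t (L ∷ v))
      (accepts-notU h (suc r) (⟦ h ≡ᵇ 0 ⟧ + t) b (L ∷ v) r+b tight refl)

    boxSum : ℕ → ℕ → ℕ → ℕ → ℕ
    boxSum m h r t = Σw m (λ v → ⟦ accepts h r t (U ∷ replicate k D ++ L ∷ v) ⟧)

    boxSum-afterBox : ∀ m h r t → boxSum m (k + h) r t ≡ Σw m (λ v → ⟦ afterBox h r t v ⟧)
    boxSum-afterBox m h r t = Σw-cong m (λ v _ → cong ⟦_⟧ (accepts-box h r t v))

    boxSum-low : ∀ m {h} r t → h < k → boxSum m h r t ≡ 0
    boxSum-low m r t h<k = Σw-zero m (λ v _ → cong ⟦_⟧ (accepts-box-low r t v h<k))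

    boxSum-zero : ∀ m r t → boxSum (suc m) k r t ≡ 0
    boxSum-zero m r t = begin
      boxSum (suc m) k r t                         ≡⟨ cong (λ h → boxSum (suc m) h r t) (sym (+-identityʳ k)) ⟩
      boxSum (suc m) (k + 0) r t                   ≡⟨ boxSum-afterBox (suc m) 0 r t ⟩
      Σw (suc m) (λ v → ⟦ afterBox 0 r t v ⟧)       ≡⟨ cong₂ _+_ (none U) (cong₂ _+_ (none D) (none L)) ⟩
      0                                            ∎
      where
      open ≡-Reasoning
      none : ∀ x → Σw m (λ v → ⟦ afterBox 0 r t (x ∷ v) ⟧) ≡ 0
      none x = Σw-zero m (λ v _ → cong ⟦_⟧ (afterBox-0 r t x v))

    boxSum-high : ∀ m h r t b → suc r + b ≡ R → 2 + (h + m) ≡ 2 * (suc b * (2 + k)) →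
      boxSum (suc m) (suc k + h) r t ≡ Σw m (⟦_⟧ ∘ accepts h (suc r) (⟦ h ≡ᵇ 0 ⟧ + t))
    boxSum-high m h r t b r+b tight = begin
      boxSum (suc m) (suc k + h) r t
        ≡⟨ cong (λ h → boxSum (suc m) h r t) (sym (+-suc k h)) ⟩
      boxSum (suc m) (k + suc h) r t
        ≡⟨ boxSum-afterBox (suc m) (suc h) r t ⟩
      Σw m (λ _ → 0) + (Σw m (λ v → ⟦ afterBox (suc h) r t (D ∷ v) ⟧)
                     +  Σw m (λ v → ⟦ afterBox (suc h) r t (L ∷ v) ⟧))
        ≡⟨ cong₂ _+_ (Σw-const0 m) (cong₂ _+_
             (Σw-cong m (λ v _ → cong ⟦_⟧ (afterBox-D h r t v)))
             (Σw-zero m (λ v |v| → cong ⟦_⟧ (afterBox-L h r t b v r+b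
               (trans (cong (λ l → 2 + (h + l)) |v|) tight))))) ⟩
      Σw m (⟦_⟧ ∘ accepts h (suc r) (⟦ h ≡ᵇ 0 ⟧ + t)) + 0
        ≡⟨ +-identityʳ _ ⟩
      Σw m (⟦_⟧ ∘ accepts h (suc r) (⟦ h ≡ᵇ 0 ⟧ + t)) ∎
      where open ≡-Reasoning

    -- With no letters left the box ends the path on the axis. Its end point is itself a return,
    -- which turns `suc J` into `J`.
    boxSum-last : ∀ r t → boxSum 0 k r t ≡ δ k R J k r t
    boxSum-last r t = begin
      boxSum 0 k r t               ≡⟨ cong (λ h → boxSum 0 h r t) (sym (+-identityʳ k)) ⟩
      boxSum 0 (k + 0) r t         ≡⟨ boxSum-afterBox 0 0 r t ⟩
      ⟦ (r + 0 ≡ᵇ R) ∧ (t + 1 ≡ᵇ suc J) ⟧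
        ≡⟨ cong₂ (λ m n → ⟦ (m ≡ᵇ R) ∧ (n ≡ᵇ suc J) ⟧) (+-identityʳ r) (+-comm t 1) ⟩
      ⟦ (r ≡ᵇ R) ∧ (t ≡ᵇ J) ⟧      ≡⟨ cong (λ b → ⟦ b ∧ (r ≡ᵇ R) ∧ (t ≡ᵇ J) ⟧) (sym (≡ᵇ-refl k)) ⟩
      δ k R J k r t                ∎
      where open ≡-Reasoning

    -- The length of a suffix with b complete blocks, u further U's and the final UDᵏL.
    wordLength : ℕ → ℕ → ℕ
    wordLength u b = suc (suc k + (u + b * (3 + k)))

    -- The hypothesis says that `u` single `U`s and `b` blocks lead from height `h` to `k`, where
    -- the last box starts.
    tight : ∀ u b h → h + u ≡ k + suc k * b → 2 + (h + wordLength u b) ≡ 2 * (suc b * (2 + k))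
    tight u b h eq = trans (regroup k u b h) (trans (cong (_+ (4 + k + b * (3 + k))) eq) (collect k b))
      where
      regroup : ∀ k u b h → 2 + (h + suc (suc k + (u + b * (3 + k)))) ≡ h + u + (4 + k + b * (3 + k))
      regroup = solve-∀
      collect : ∀ k b → k + suc k * b + (4 + k + b * (3 + k)) ≡ 2 * (suc b * (2 + k))
      collect = solve-∀

    mutual
      -- Induction along `accepts-split`: a single `U` lowers `u`, a block lowers `b`. A branch
      -- whose kind of step is used up vanishes on both sides, except that for `u` and `b` both zero
      -- the last box remains.
      Σw-accepts : ∀ u b h r t → h + u ≡ k + suc k * b → r + b ≡ R →
        Σw (wordLength u b) (⟦_⟧ ∘ accepts h r t) ≡ run (u + b) (δ k R J) h r t
      Σw-accepts u b h r t h+u r+b = trans (accepts-split h r t b (u + b * (3 + k)) r+b (tight u b h h+u))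
        (Σw-accepts-split u b h r t h+u r+b)

      Σw-accepts-split : ∀ u b h r t → h + u ≡ k + suc k * b → r + b ≡ R →
        Σw (suc k + (u + b * (3 + k))) (⟦_⟧ ∘ accepts (suc h) r t) + boxSum (u + b * (3 + k)) h r t
          ≡ run (u + b) (δ k R J) h r t
      Σw-accepts-split (suc u) zero h r t h+u r+b = cong₂ _+_ (Σw-accepts-U u 0 h r t h+u r+b)
        (trans (boxSum-low (suc u + 0) r t h<k) (sym (down-< _ (m≤n⇒m≤1+n h<k))))
        where
        h<k : h < k
        h<k = subst (h <_) (trans h+u (trans (cong (k +_) (*-zeroʳ (suc k))) (+-identityʳ k)))
          (m<m+n h (s≤s z≤n))
      Σw-accepts-split (suc u) (suc b) h r t h+u r+b = cong₂ _+_ (Σw-accepts-U u (suc b) h r t h+u r+b)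
        (subst (λ s → boxSum (suc u + suc b * (3 + k)) h r t
            ≡ down (suc k) (λ h′ → run s (δ k R J) h′ (suc r) (⟦ h′ ≡ᵇ 0 ⟧ + t)) h)
          (sym (+-suc u b)) (boxSum-down (suc u) b h r t h+u r+b))
      Σw-accepts-split zero zero h r t h+u r+b = cong₂ _+_ (Σw-accepts-short 0 h r t h+u r+b)
        (subst (λ h → boxSum 0 h r t ≡ δ k R J h r t) (sym h≡k) (boxSum-last r t))
        where
        h≡k : h ≡ k
        h≡k = trans (sym (+-identityʳ h)) (trans h+u (trans (cong (k +_) (*-zeroʳ (suc k))) (+-identityʳ k)))
      Σw-accepts-split zero (suc b) h r t h+u r+b = cong₂ _+_
        -- After one more `U` only `b` steps of the walk remain, too few for the `suc b` blocks
        -- still due.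
        (trans (Σw-accepts-short (suc b) h r t h+u r+b) (sym (run-few b (suc h) r t b+r<R)))
        (boxSum-down 0 b h r t h+u r+b)
        where
        b+r<R : b + r < R
        b+r<R = ≤-reflexive (trans (+-comm (suc b) r) r+b)

      Σw-accepts-U : ∀ u b h r t → h + suc u ≡ k + suc k * b → r + b ≡ R →
        Σw (suc k + (suc u + b * (3 + k))) (⟦_⟧ ∘ accepts (suc h) r t) ≡ run (u + b) (δ k R J) (suc h) r t
      Σw-accepts-U u b h r t h+u r+b = trans
        (cong (λ m → Σw m (⟦_⟧ ∘ accepts (suc h) r t)) (+-suc (suc k) (u + b * (3 + k))))
        (Σw-accepts u b (suc h) r t (trans (sym (+-suc h u)) h+u) r+b)

      Σw-accepts-short : ∀ b h r t → h + 0 ≡ k + suc k * b → r + b ≡ R →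
        Σw (suc k + b * (3 + k)) (⟦_⟧ ∘ accepts (suc h) r t) ≡ 0
      Σw-accepts-short b h r t h+u r+b = Σw-zero (suc k + b * (3 + k)) λ w |w| → cong ⟦_⟧
        (accepts-short (suc h) r t b w r+b (≤-reflexive (trans |w| (trans (collect k b)
          (cong (λ h → suc h + (b + b)) (trans (sym h+u) (+-identityʳ h)))))))
        where
        collect : ∀ k b → suc k + b * (3 + k) ≡ suc (k + suc k * b) + (b + b)
        collect = solve-∀

      -- Below height `k` the box crosses the axis; from `k` it ends at 0 with letters left; from
      -- higher up it is completed by `D` to a block.
      boxSum-down : ∀ u b h r t → h + u ≡ k + suc k * suc b → r + suc b ≡ R →
        boxSum (u + suc b * (3 + k)) h r t
          ≡ down (suc k) (λ h′ → run (u + b) (δ k R J) h′ (suc r) (⟦ h′ ≡ᵇ 0 ⟧ + t)) h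
      boxSum-down u b h r t h+u r+b = trans (cong (λ m → boxSum m h r t) (regroup k u b))
        (down-elim (suc k) _ h low high)
        where
        regroup : ∀ k u b → u + suc b * (3 + k) ≡ suc (suc (suc k + (u + b * (3 + k))))
        regroup = solve-∀
        low : h < suc k → boxSum (suc (wordLength u b)) h r t ≡ 0
        low (s≤s h≤k) with m≤n⇒m<n∨m≡n h≤k
        ... | inj₁ h<k  = boxSum-low (suc (wordLength u b)) r t h<k
        ... | inj₂ refl = boxSum-zero (wordLength u b) r t
        high : ∀ h′ → h ≡ suc k + h′ →
          boxSum (suc (wordLength u b)) h r t ≡ run (u + b) (δ k R J) h′ (suc r) (⟦ h′ ≡ᵇ 0 ⟧ + t)
        high h′ refl = trans (boxSum-high (wordLength u b) h′ r t b r+b′ (tight u b h′ h′+u))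
          (Σw-accepts u b h′ (suc r) _ h′+u r+b′)
          where
          r+b′ = trans (sym (+-suc r b)) r+b
          h′+u : h′ + u ≡ k + suc k * b
          h′+u = +-cancelˡ-≡ (suc k) _ _ (trans (sym (+-assoc (suc k) h′ u)) (trans h+u (shift k b)))
            where
            shift : ∀ k b → k + suc k * suc b ≡ suc k + (k + suc k * b)
            shift = solve-∀

  -- Reading walks backwards.

  -- As run applies step at the start of the walk, this moves one step to its end; applied to
  -- the indicators δ it gives the recursion for walks read backwards.
  run-step : ∀ s f h r t → run (suc s) f h r t ≡ run s (step f) h r t
  run-step zero    f h r t = refl
  run-step (suc s) f h r t = cong₂ _+_ (run-step s f (suc h) r t)
    (down-cong (suc k) (λ h′ → run-step s f h′ (suc r) _) h)

  run-+ : ∀ s f g h r t → run s (λ h r t → f h r t + g h r t) h r t ≡ run s f h r t + run s g h r t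
  run-+ zero    f g h r t = refl
  run-+ (suc s) f g h r t = trans
    (cong₂ _+_ (run-+ s f g (suc h) r t)
      (trans (down-cong (suc k) (λ h′ → run-+ s f g h′ (suc r) _) h)
        (down-+ (suc k) (λ h′ → run s f h′ _ _) (λ h′ → run s g h′ _ _) h)))
    (shuffle (run s f (suc h) r t) _ _ _)
    where
    shuffle : ∀ a b c d → (a + b) + (c + d) ≡ (a + c) + (b + d)
    shuffle = solve-∀

  run-const0 : ∀ s h r t → run s (λ _ _ _ → 0) h r t ≡ 0
  run-const0 zero    h r t = refl
  run-const0 (suc s) h r t = cong₂ _+_ (run-const0 s (suc h) r t)
    (trans (down-cong (suc k) (λ h′ → run-const0 s h′ (suc r) _) h) (down-const0 (suc k) h))

  -- This and the next three lemmas list the predecessors of an end state. A `U` cannot end at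
  -- height 0, a block cannot end with no box made, and a block makes a return exactly when it ends
  -- at height 0.
  step-δ-suc-zero : ∀ h₀ t₀ h r t → step (δ (suc h₀) 0 t₀) h r t ≡ δ h₀ 0 t₀ h r t
  step-δ-suc-zero h₀ t₀ h r t = trans
    (cong (δ h₀ 0 t₀ h r t +_) (trans
      (down-cong (suc k) (λ h′ → cong ⟦_⟧ (∧-zeroʳ (h′ ≡ᵇ suc h₀))) h) (down-const0 (suc k) h)))
    (+-identityʳ _)

  step-δ-suc-suc : ∀ h₀ r₀ t₀ h r t →
    step (δ (suc h₀) (suc r₀) t₀) h r t ≡ δ h₀ (suc r₀) t₀ h r t + δ (suc k + suc h₀) r₀ t₀ h r t
  step-δ-suc-suc h₀ r₀ t₀ h r t = cong (δ h₀ (suc r₀) t₀ h r t +_) (trans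
    (down-cong (suc k) (λ { zero → refl ; (suc h′) → refl }) h)
    (down-indicator (suc k) {suc h₀} h))

  step-δ-zero-suc-zero : ∀ r₀ h r t → step (δ 0 (suc r₀) 0) h r t ≡ 0
  step-δ-zero-suc-zero r₀ h r t =
    trans (down-cong (suc k) (λ { zero → cong ⟦_⟧ (∧-zeroʳ (r ≡ᵇ r₀)) ; (suc h′) → refl }) h)
      (down-const0 (suc k) h)

  step-δ-zero-suc-suc : ∀ r₀ t₀ h r t → step (δ 0 (suc r₀) (suc t₀)) h r t ≡ δ (suc k) r₀ t₀ h r t
  step-δ-zero-suc-suc r₀ t₀ h r t = trans
    (down-cong (suc k) (λ { zero → refl ; (suc h′) → refl }) h)
    (trans (down-indicator (suc k) {0} h) (cong (λ i → δ i r₀ t₀ h r t) (+-identityʳ (suc k))))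

  -- First passages and their closed form.

  -- First passages from h to 0 with r jumps up by k + 1, all other steps going down by 1.
  passages : ℕ → ℕ → ℕ
  passages h       zero    = 1
  passages zero    (suc r) = 0
  passages (suc h) (suc r) = passages h (suc r) + passages (suc k + suc h) r

  -- As passages, but passing through 0 on the way, where exactly t of the r jumps are made.
  walks : ℕ → ℕ → ℕ → ℕ
  walks h r       zero    = passages h r
  walks h zero    (suc t) = 0
  walks h (suc r) (suc t) = walks (suc k + h) r t

  walks-suc-zero : ∀ h t → walks (suc h) 0 t ≡ walks h 0 t
  walks-suc-zero h zero    = refl
  walks-suc-zero h (suc t) = refl

  walks-suc-suc : ∀ h r t → walks (suc h) (suc r) t ≡ walks h (suc r) t + walks (suc k + suc h) r t
  walks-suc-suc h r       zero          = refl
  walks-suc-suc h zero    (suc zero)    = refl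
  walks-suc-suc h zero    (suc (suc t)) = refl
  walks-suc-suc h (suc r) (suc t)       = trans (walks-suc-suc (k + suc h) r t)
    (cong (λ i → walks i (suc r) t + walks (suc k + (suc k + suc h)) r t) (+-suc k h))

  walks-passages : ∀ h t e → walks h (t + e) t ≡ passages (h + t * suc k) e
  walks-passages h zero    e = cong (λ h → passages h e) (sym (+-identityʳ h))
  walks-passages h (suc t) e = trans (walks-passages (suc k + h) t e)
    (cong (λ h → passages h e) (shuffle k h (t * suc k)))
    where
    shuffle : ∀ k h x → suc k + h + x ≡ h + (suc k + x)
    shuffle = solve-∀

  -- The end state fixes the number of steps: `r` blocks and `h + r * suc k` single `U`s. The
  -- induction removes the last step.
  run-walks : ∀ s h r t → s ≡ h + r * (2 + k) → run s (δ h r t) 0 0 0 ≡ walks h r t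
  run-walks zero    zero    zero    zero    _  = refl
  run-walks zero    zero    zero    (suc t) _  = refl
  run-walks (suc s) zero    (suc r) zero    eq = begin
    run (suc s) (δ 0 (suc r) 0) 0 0 0    ≡⟨ run-step s (δ 0 (suc r) 0) 0 0 0 ⟩
    run s (step (δ 0 (suc r) 0)) 0 0 0   ≡⟨ run-cong s (step-δ-zero-suc-zero r) 0 0 0 ⟩
    run s (λ _ _ _ → 0) 0 0 0            ≡⟨ run-const0 s 0 0 0 ⟩
    0                                    ∎
    where open ≡-Reasoning
  run-walks (suc s) zero    (suc r) (suc t) eq = begin
    run (suc s) (δ 0 (suc r) (suc t)) 0 0 0    ≡⟨ run-step s (δ 0 (suc r) (suc t)) 0 0 0 ⟩
    run s (step (δ 0 (suc r) (suc t))) 0 0 0   ≡⟨ run-cong s (step-δ-zero-suc-suc r t) 0 0 0 ⟩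
    run s (δ (suc k) r t) 0 0 0                ≡⟨ run-walks s (suc k) r t (suc-injective eq) ⟩
    walks (suc k) r t                              ≡⟨ cong (λ h → walks h r t) (sym (+-identityʳ (suc k))) ⟩
    walks (suc k + 0) r t                          ∎
    where open ≡-Reasoning
  run-walks (suc s) (suc h) zero    t       eq = begin
    run (suc s) (δ (suc h) 0 t) 0 0 0    ≡⟨ run-step s (δ (suc h) 0 t) 0 0 0 ⟩
    run s (step (δ (suc h) 0 t)) 0 0 0   ≡⟨ run-cong s (step-δ-suc-zero h t) 0 0 0 ⟩
    run s (δ h 0 t) 0 0 0                ≡⟨ run-walks s h 0 t (suc-injective eq) ⟩
    walks h 0 t                              ≡⟨ sym (walks-suc-zero h t) ⟩
    walks (suc h) 0 t                        ∎
    where open ≡-Reasoning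
  run-walks (suc s) (suc h) (suc r) t       eq = begin
    run (suc s) (δ (suc h) (suc r) t) 0 0 0
      ≡⟨ run-step s (δ (suc h) (suc r) t) 0 0 0 ⟩
    run s (step (δ (suc h) (suc r) t)) 0 0 0
      ≡⟨ run-cong s (step-δ-suc-suc h r t) 0 0 0 ⟩
    run s (λ h′ r′ t′ → δ h (suc r) t h′ r′ t′ + δ (suc k + suc h) r t h′ r′ t′) 0 0 0
      ≡⟨ run-+ s (δ h (suc r) t) (δ (suc k + suc h) r t) 0 0 0 ⟩
    run s (δ h (suc r) t) 0 0 0 + run s (δ (suc k + suc h) r t) 0 0 0
      ≡⟨ cong₂ _+_ (run-walks s h (suc r) t (suc-injective eq))
           (run-walks s (suc k + suc h) r t (trans (suc-injective eq) (shuffle k h (r * (2 + k))))) ⟩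
    walks h (suc r) t + walks (suc k + suc h) r t
      ≡⟨ sym (walks-suc-suc h r t) ⟩
    walks (suc h) (suc r) t ∎
    where
    open ≡-Reasoning
    shuffle : ∀ k h x → h + (2 + k + x) ≡ suc k + suc h + x
    shuffle = solve-∀

  -- These are the Raney numbers, with the denominator cleared.
  passages-closed : ∀ h r → passages h r * (h + r * (2 + k)) ≡ h * ((h + r * (2 + k)) C r)
  passages-closed h       zero    = begin
    1 * (h + 0)              ≡⟨ *-identityˡ (h + 0) ⟩
    h + 0                    ≡⟨ +-identityʳ h ⟩
    h                        ≡⟨ sym (*-identityʳ h) ⟩
    h * ((h + 0) C 0)        ∎
    where open ≡-Reasoning
  passages-closed zero    (suc r) = refl
  -- Both terms of the recursion have the same denominator `M`, while the sum has `suc M`. The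
  -- factor `M` clears the former, and `suc r` lets absorption express everything through `M C r`.
  passages-closed (suc h) (suc r) = *-cancelʳ-≡ _ _ (M * suc r) {{m*n≢0 M (suc r) {{M≢0}}}} (begin
    (P₁ + P₂) * suc M * (M * suc r)
      ≡⟨ expand P₁ P₂ M (suc r) ⟩
    suc M * ((P₁ * M + P₂ * M) * suc r)
      ≡⟨ cong (λ x → suc M * (x * suc r)) (cong₂ _+_ (passages-closed h (suc r)) P₂-closed) ⟩
    suc M * ((h * p + (suc k + suc h) * c) * suc r)
      ≡⟨ regroup (suc M) h p c k (suc r) ⟩
    suc M * (h * (suc r * (c + p)) + (2 + k) * suc r * c)
      ≡⟨ cong (λ x → suc M * (h * x + (2 + k) * suc r * c)) absorb ⟩
    suc M * (h * (suc M * c) + (2 + k) * suc r * c)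
      ≡⟨ factor h k r c ⟩
    suc h * (suc M * c) * M
      ≡⟨ cong (λ x → suc h * x * M) (sym absorb) ⟩
    suc h * (suc r * (c + p)) * M
      ≡⟨ swap (suc h) (suc r) (c + p) M ⟩
    suc h * (c + p) * (M * suc r)
      ≡⟨ cong (λ x → suc h * x * (M * suc r)) (nCk+nC[k+1]≡[n+1]C[k+1] M r) ⟩
    suc h * (suc M C suc r) * (M * suc r) ∎)
    where
    open ≡-Reasoning
    M = h + suc r * (2 + k)
    P₁ = passages h (suc r)
    P₂ = passages (suc k + suc h) r
    c = M C r
    p = M C suc r
    M≢0 : NonZero M
    M≢0 = subst NonZero (sym (+-suc h _)) _
    P₂-closed : P₂ * M ≡ (suc k + suc h) * c
    P₂-closed = subst (λ m → P₂ * m ≡ (suc k + suc h) * (m C r)) (shuffle k h (r * (2 + k)))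
      (passages-closed (suc k + suc h) r)
      where
      shuffle : ∀ k h x → suc k + suc h + x ≡ h + (2 + k + x)
      shuffle = solve-∀
    absorb : suc r * (c + p) ≡ suc M * c
    absorb = trans (cong (suc r *_) (nCk+nC[k+1]≡[n+1]C[k+1] M r)) (nCk-absorption M r)
    expand : ∀ a b m s → (a + b) * suc m * (m * s) ≡ suc m * ((a * m + b * m) * s)
    expand = solve-∀
    regroup : ∀ m h p c k s → m * ((h * p + (suc k + suc h) * c) * s) ≡ m * (h * (s * (c + p)) + (2 + k) * s * c)
    regroup = solve-∀
    factor : ∀ h k r c → let m = h + suc r * (2 + k) in
      suc m * (h * (suc m * c) + (2 + k) * suc r * c) ≡ suc h * (suc m * c) * m
    factor = solve-∀
    swap : ∀ a s x m → a * (s * x) * m ≡ a * x * (m * s)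
    swap = solve-∀

  -- The number of k-box paths with given returns.

  kBoxPathsWithReturns-Σw : ∀ R J →
    kBoxPathsWithReturns k (suc R) (suc J) ≡ Σw (2 * ((k + 2) * suc R ∸ 1)) (⟦_⟧ ∘ accepts R J 0 0 0)
  kBoxPathsWithReturns-Σw R J = begin
    countWhere stats (skewDyckPaths m)                          ≡⟨ cong (countWhere stats) (skewDyckPaths-filterᵇ m) ⟩
    countWhere stats (filterᵇ isSkewDyck (words (2 * m)))       ≡⟨ countWhere-filterᵇ stats isSkewDyck (words (2 * m)) ⟩
    countWhere (λ w → isSkewDyck w ∧ stats w) (words (2 * m))   ≡⟨ countWhere-words (2 * m) _ ⟩
    Σw (2 * m) (λ w → ⟦ isSkewDyck w ∧ stats w ⟧)               ≡⟨ Σw-cong (2 * m) (λ w _ → cong ⟦_⟧ (pointwise w)) ⟩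
    Σw (2 * m) (⟦_⟧ ∘ accepts R J 0 0 0)                        ∎
    where
    open ≡-Reasoning
    m = (k + 2) * suc R ∸ 1
    stats : List Step → Bool
    stats w = (occurrences (box k) w ≡ᵇ suc R) ∧ (returns w ≡ᵇ suc J)
    pointwise : ∀ w → isSkewDyck w ∧ stats w ≡ accepts R J 0 0 0 w
    -- The two return counts need to agree only on good words; on the others both tests fail.
    pointwise w rewrite isSkewDyck-good w with good 0 w in eq
    ... | true  rewrite returnsFrom-rets 0 w eq = ∧-assoc (noULorLU w) true _
    ... | false = ∧-assoc (noULorLU w) false _

  kBoxPathsWithReturns-passages : ∀ J e →
    kBoxPathsWithReturns k (suc (J + e)) (suc J) ≡ passages (k + J * suc k) e
  kBoxPathsWithReturns-passages J e = begin
    kBoxPathsWithReturns k (suc R) (suc J)                     ≡⟨ kBoxPathsWithReturns-Σw R J ⟩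
    Σw (2 * ((k + 2) * suc R ∸ 1)) (⟦_⟧ ∘ accepts R J 0 0 0)
      ≡⟨ cong (λ m → Σw m (⟦_⟧ ∘ accepts R J 0 0 0))
           (trans (cong (λ m → 2 * (m ∸ 1)) (peel κ R)) (length≡ κ R)) ⟩
    Σw (wordLength R J u R) (⟦_⟧ ∘ accepts R J 0 0 0)          ≡⟨ Σw-accepts R J u R 0 0 0 refl refl ⟩
    run (u + R) (δ k R J) 0 0 0                                ≡⟨ run-walks (u + R) k R J (steps κ R) ⟩
    walks k R J                                                ≡⟨ walks-passages k J e ⟩
    passages (k + J * suc k) e                                 ∎
    where
    open ≡-Reasoning
    R = J + e
    u = k + suc k * R
    peel : ∀ κ R → (suc κ + 2) * suc R ≡ suc (suc κ + suc R + R * (2 + κ))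
    peel = solve-∀
    length≡ : ∀ κ R → let k = suc κ in
      2 * (suc κ + suc R + R * (2 + κ)) ≡ suc (suc k + (k + suc k * R + R * (3 + k)))
    length≡ = solve-∀
    steps : ∀ κ R → let k = suc κ in k + suc k * R + R ≡ k + R * (2 + k)
    steps = solve-∀

  kBoxPaths-closed : ∀ J e → let N = k + J * suc k + e * (2 + k) in
    kBoxPathsWithReturns k (suc (J + e)) (suc J) * N ≡ (k + J * suc k) * (N C e)
  kBoxPaths-closed J e = trans
    (cong (_* (k + J * suc k + e * (2 + k))) (kBoxPathsWithReturns-passages J e))
    (passages-closed (k + J * suc k) e)

  -- With `κ` in place of `k`, `N` is one less than the upper index in `kBoxPaths-closed`;
  -- absorption then trades the factor `suc N` for `suc e`.
  kBoxPaths-closed-below : ∀ J e → let N = κ + J * suc k + suc e * (2 + k) in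
    kBoxPathsWithReturns k (suc (J + suc e)) (suc J) * suc e ≡ (k + J * suc k) * (N C e)
  kBoxPaths-closed-below J e = *-cancelʳ-≡ _ _ (suc N) (begin
    X * suc e * suc N              ≡⟨ swap X (suc e) (suc N) ⟩
    suc e * (X * suc N)            ≡⟨ cong (suc e *_) (kBoxPaths-closed J (suc e)) ⟩
    suc e * (a * (suc N C suc e))  ≡⟨ swap′ (suc e) a _ ⟩
    a * (suc e * (suc N C suc e))  ≡⟨ cong (a *_) (nCk-absorption N e) ⟩
    a * (suc N * (N C e))          ≡⟨ swap″ a (suc N) _ ⟩
    a * (N C e) * suc N            ∎)
    where
    open ≡-Reasoning
    N = κ + J * suc k + suc e * (2 + k)
    X = kBoxPathsWithReturns k (suc (J + suc e)) (suc J)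
    a = k + J * suc k
    swap : ∀ x e n → x * e * n ≡ e * (x * n)
    swap = solve-∀
    swap′ : ∀ e a x → e * (a * x) ≡ a * (e * x)
    swap′ = solve-∀
    swap″ : ∀ a n x → a * (n * x) ≡ a * x * n
    swap″ = solve-∀

numerator≡ : ∀ κ J → suc J * (suc κ + 1) ≡ suc (suc κ + J * suc (suc κ))
numerator≡ = solve-∀

upper≡ : ∀ κ J e → (suc κ + 2) * suc (J + e) ∸ suc J ≡ suc (suc κ + J * suc (suc κ) + e * (2 + suc κ))
upper≡ κ J e = trans (cong (_∸ suc J) (regroup κ J e)) (m+n∸m≡n (suc J) _)
  where
  regroup : ∀ κ J e →
    (suc κ + 2) * suc (J + e) ≡ suc J + suc (suc κ + J * suc (suc κ) + e * (2 + suc κ))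
  regroup = solve-∀

theorem6p2 : (k n j : ℕ) → 1 ≤ k → 1 ≤ n → 1 ≤ j → j ≤ n →
    (kBoxPathsWithReturns k n j * ((k + 2) * n ∸ j ∸ 1)
    ≡ (j * (k + 1) ∸ 1) * (((k + 2) * n ∸ j ∸ 1) C (n ∸ j)))
    × (j < n →
    kBoxPathsWithReturns k n j * (n ∸ j)
    ≡ (j * (k + 1) ∸ 1) * (((k + 2) * n ∸ j ∸ 2) C (n ∸ j ∸ 1)))
theorem6p2 (suc κ) (suc R) (suc J) _ _ _ (s≤s J≤R) with m≤n⇒∃[o]m+o≡n J≤R
... | e , refl =
  -- The substitutions replace truncated differences by successor forms, on which `∸ 1` and `∸ 2`
  -- compute.
  subst (λ a → P a upper (suc R ∸ suc J)) (sym (cong (_∸ 1) (numerator≡ κ J)))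
  (subst (λ T → P (suc κ + J * suc (suc κ)) T (suc R ∸ suc J)) (sym (upper≡ κ J e))
  (subst (P (suc κ + J * suc (suc κ)) (suc (suc κ + J * suc (suc κ) + e * (2 + suc κ)))) (sym (m+n∸m≡n J e))
  (Boxes.kBoxPaths-closed κ J e , second e)))
  where
  X upper : ℕ
  X     = kBoxPathsWithReturns (suc κ) (suc R) (suc J)
  upper = (suc κ + 2) * suc R ∸ suc J
  P : ℕ → ℕ → ℕ → Set
  P a T d = (X * (T ∸ 1) ≡ a * ((T ∸ 1) C d))
          × (suc J < suc R → X * d ≡ a * ((T ∸ 2) C (d ∸ 1)))
  second : ∀ e → suc J < suc (J + e) → kBoxPathsWithReturns (suc κ) (suc (J + e)) (suc J) * e
    ≡ (suc κ + J * suc (suc κ)) * ((κ + J * suc (suc κ) + e * (2 + suc κ)) C (e ∸ 1))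
  second zero    J<J = ⊥-elim (<-irrefl (sym (cong suc (+-identityʳ J))) J<J)
  second (suc e) _   = Boxes.kBoxPaths-closed-below κ J e
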